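{- Let $k,\ell$ be positive integers. Then $$\mathcal{D}(P_k\,\square\,P_\ell,\mathcal{T})>\frac{k\ell}{8}-\frac{\max\{k,\ell\}}{8}-\min\{k,\ell\}.$$ That is, for every labeling $f$ of the edges of $P_k\,\square\,P_\ell$ by $\{ -1,1\}$ there is a (not necessarily spanning) subtree $T$ of $P_k\,\square\,P_\ell$ with $\left|\sum_{e\in E(T)}f(e)\right|>k\ell/8-\max\{k,\ell\}/8-\min\{k,\ell\}$.
   Context: $P_k$ is the path on $k$ vertices and $\square$ is the Cartesian product of graphs, so $P_k\,\square\,P_\ell$ is the $k\times\ell$ grid graph. For a graph $G$, a family $\mathcal{S}_G$ of subgraphs of $G$ and $f:E(G)\to\{ -1,1\}$, put $f(S)=\sum_{e\in E(S)}f(e)$ for $S\in\mathcal{S}_G$; the discrepancy is $\mathcal{D}(G,\mathcal{S}_G)=\min_f\max_{S\in\mathcal{S}_G}|f(S)|$, the minimum being over all $f:E(G)\to\{ -1,1\}$. $\mathcal{T}$ is the set of all (not necessarily spanning) trees that are subgraphs of $G$; a single vertex counts as a tree. -}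

module Defs where

open import Algebra.Properties.CommutativeMonoid.Sum using (sum)
open import Data.Bool.Base using (true; false; if_then_else_)
open import Data.Fin.Base
  using (Fin; zero; suc; toℕ; inject₁; fromℕ<; combine; remQuot; splitAt; join)
open import Data.Fin.Properties
  using (_≟_; all?; any?; inject₁-injective; toℕ-inject₁; toℕ-fromℕ<;
         combine-injective; combine-remQuot; join-splitAt; injective⇒≤)
open import Data.Fin.Subset using (Subset; _∈_; Nonempty)
open import Data.Fin.Subset.Properties using (_∈?_; nonempty?)
open import Data.Integer.Base as ℤ using (ℤ; ∣_∣; _◃_; 0ℤ)
import Data.Integer.Properties as ℤ
open import Data.List.Base as List
  using (List; []; _∷_; _∷ʳ_; allFin; cartesianProduct; cartesianProductWith;
         mapMaybe; filter; length)
open import Data.List.Extrema.Nat using (min; max)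
import Data.List.Membership.Propositional as List∈
open import Data.List.Membership.Propositional.Properties
  using (∈-cartesianProductWith⁺; ∈-allFin)
open import Data.List.Relation.Unary.All as All using (All)
open import Data.List.Relation.Unary.AllPairs using ([]; _∷_)
import Data.List.Relation.Unary.Any as Any
open import Data.List.Relation.Unary.Linked using (Linked; linked?)
open import Data.List.Relation.Unary.Unique.Propositional using (Unique)
import Data.List.Relation.Unary.Unique.DecPropositional as DecUnique
open import Data.Maybe.Base as Maybe using (Maybe)
open import Data.Nat.Base as ℕ using (ℕ; zero; suc; _+_; _*_; _≤_)
import Data.Nat.Properties as ℕ
open import Data.Product.Base as Product
  using (∃; ∃₂; _×_; _,_; proj₁; proj₂; uncurry)
open import Data.Sign.Base as Sign using (Sign)
open import Data.Sum.Base as Sum using (_⊎_; inj₁; inj₂)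
open import Data.Vec.Base as Vec using (Vec; []; _∷_)
open import Data.Vec.Properties using (toList∘fromList)
open import Function.Base using (_∘_)
open import Function.Definitions using (Injective)
open import Relation.Binary.Construct.Closure.ReflexiveTransitive
  using (Star; ε; _◅_; _◅◅_)
import Relation.Binary.Definitions as Binary
open import Relation.Binary.PropositionalEquality
  using (_≡_; _≢_; refl; sym; trans; cong; cong₂; subst)
open import Relation.Nullary using (¬_; Dec; yes; no; contradiction)
open import Relation.Nullary.Decidable
  using (map′; ¬?; _×-dec_; _⊎-dec_; _→-dec_; dec⇒maybe)
open import Relation.Unary using (Decidable)

Joined : ∀ {n m} (src tgt : Fin m → Fin n) → Fin m → Fin n → Fin n → Set
Joined src tgt e u v = (src e ≡ u × tgt e ≡ v) ⊎ (src e ≡ v × tgt e ≡ u)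

-- The vertices are Fin order and the edges Fin size.  The orientation of an
-- edge from src to tgt is only a presentation: everything below goes through
-- Joins, which is symmetric in the two vertices.
record Graph : Set where
  field
    order size : ℕ
    src tgt    : Fin size → Fin order

  Joins : Fin size → Fin order → Fin order → Set
  Joins = Joined src tgt

  field
    loopless : ∀ e → src e ≢ tgt e
    simple   : ∀ {e e′ u v} → Joins e u v → Joins e′ u v → e ≡ e′

open Graph public

module _ where
  private
    suc≢inject₁ : ∀ {n} {i j : Fin n} → inject₁ i ≡ suc j → inject₁ j ≢ suc i
    suc≢inject₁ {i = i} {j} p q = ℕ.m≢1+n+m (toℕ i) {1} (trans
      (trans (sym (toℕ-inject₁ i)) (cong toℕ p))
      (cong suc (trans (sym (toℕ-inject₁ j)) (cong toℕ q))))

  -- Vertices 0, …, k - 1, with edge i joining i and i + 1.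
  path : ℕ → Graph
  path zero = record
    { order = 0 ; size = 0 ; src = λ () ; tgt = λ ()
    ; loopless = λ () ; simple = λ { {()} } }
  path (suc n) = record
    { order = suc n ; size = n ; src = inject₁ ; tgt = suc
    ; loopless = λ e p → suc≢inject₁ p p
    ; simple = λ where
        (inj₁ (p , _)) (inj₁ (r , _)) → inject₁-injective (trans p (sym r))
        (inj₁ (p , q)) (inj₂ (r , s)) →
          contradiction (trans r (sym q)) (suc≢inject₁ (trans p (sym s)))
        (inj₂ (p , q)) (inj₁ (r , s)) →
          contradiction (trans r (sym q)) (suc≢inject₁ (trans p (sym s)))
        (inj₂ (p , _)) (inj₂ (r , _)) → inject₁-injective (trans p (sym r))
    }

module _ (G H : Graph) where
  private
    V  = Fin (order G) × Fin (order H)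
    E  = (Fin (size G) × Fin (order H)) ⊎ (Fin (order G) × Fin (size H))
    E# = size G * order H + order G * size H

    code : V → Fin (order G * order H)
    code = uncurry combine

    edge : Fin E# → E
    edge = Sum.map (remQuot (order H)) (remQuot (size H)) ∘ splitAt (size G * order H)

    s t : E → V
    s (inj₁ (e , v)) = src G e , v
    s (inj₂ (u , e)) = u , src H e
    t (inj₁ (e , v)) = tgt G e , v
    t (inj₂ (u , e)) = u , tgt H e

    code-injective : ∀ {x y} → code x ≡ code y → x ≡ y
    code-injective {u , v} {u′ , v′} p with combine-injective u v u′ v′ p
    ... | refl , refl = refl

    edge-injective : ∀ {i j} → edge i ≡ edge j → i ≡ j
    edge-injective {i} {j} p = trans (sym (back i)) (trans (cong unedge p) (back j))
      where
      unedge : E → Fin E#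
      unedge = join _ _ ∘ Sum.map (uncurry combine) (uncurry combine)
      back : ∀ i → unedge (edge i) ≡ i
      back i with splitAt (size G * order H) i | join-splitAt (size G * order H) (order G * size H) i
      ... | inj₁ x | q = trans (cong (join _ _ ∘ inj₁) (combine-remQuot {size G} (order H) x)) q
      ... | inj₂ y | q = trans (cong (join (size G * order H) _ ∘ inj₂) (combine-remQuot {order G} (size H) y)) q

    loopless′ : ∀ e → s e ≢ t e
    loopless′ (inj₁ (e , v)) p = loopless G e (cong proj₁ p)
    loopless′ (inj₂ (u , e)) p = loopless H e (cong proj₂ p)

    same : ∀ e e′ → s e ≡ s e′ → t e ≡ t e′ → e ≡ e′
    same (inj₁ (e , v)) (inj₁ (e′ , v′)) p q = cong₂ (λ x y → inj₁ (x , y))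
      (simple G (inj₁ (cong proj₁ p , cong proj₁ q)) (inj₁ (refl , refl))) (cong proj₂ p)
    same (inj₁ (e , v)) (inj₂ (u , e′)) p q =
      contradiction (trans (cong proj₁ p) (sym (cong proj₁ q))) (loopless G e)
    same (inj₂ (u , e)) (inj₁ (e′ , v)) p q =
      contradiction (trans (cong proj₂ p) (sym (cong proj₂ q))) (loopless H e)
    same (inj₂ (u , e)) (inj₂ (u′ , e′)) p q = cong₂ (λ x y → inj₂ (x , y)) (cong proj₁ p)
      (simple H (inj₁ (cong proj₂ p , cong proj₂ q)) (inj₁ (refl , refl)))

    flip : ∀ e e′ → s e ≡ t e′ → t e ≡ s e′ → e ≡ e′
    flip (inj₁ (e , v)) (inj₁ (e′ , v′)) p q = cong₂ (λ x y → inj₁ (x , y))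
      (simple G (inj₁ (cong proj₁ p , cong proj₁ q)) (inj₂ (refl , refl))) (cong proj₂ p)
    flip (inj₁ (e , v)) (inj₂ (u , e′)) p q =
      contradiction (trans (cong proj₁ p) (sym (cong proj₁ q))) (loopless G e)
    flip (inj₂ (u , e)) (inj₁ (e′ , v)) p q =
      contradiction (trans (cong proj₂ p) (sym (cong proj₂ q))) (loopless H e)
    flip (inj₂ (u , e)) (inj₂ (u′ , e′)) p q = cong₂ (λ x y → inj₂ (x , y)) (cong proj₁ p)
      (simple H (inj₁ (cong proj₂ p , cong proj₂ q)) (inj₂ (refl , refl)))

    inj : ∀ {x y z} → code x ≡ z → code y ≡ z → x ≡ y
    inj p q = code-injective (trans p (sym q))

    S T : Fin E# → Fin (order G * order H)
    S = code ∘ s ∘ edge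
    T = code ∘ t ∘ edge

    simple′ : ∀ {e e′ u v} → Joined S T e u v → Joined S T e′ u v → e ≡ e′
    simple′ {e} {e′} (inj₁ (p , q)) (inj₁ (p′ , q′)) =
      edge-injective (same (edge e) (edge e′) (inj p p′) (inj q q′))
    simple′ {e} {e′} (inj₁ (p , q)) (inj₂ (p′ , q′)) =
      edge-injective (flip (edge e) (edge e′) (inj p q′) (inj q p′))
    simple′ {e} {e′} (inj₂ (p , q)) (inj₁ (p′ , q′)) =
      edge-injective (flip (edge e) (edge e′) (inj p q′) (inj q p′))
    simple′ {e} {e′} (inj₂ (p , q)) (inj₂ (p′ , q′)) =
      edge-injective (same (edge e) (edge e′) (inj p p′) (inj q q′))

  infixr 7 _□_

  -- The vertex (u , v) is combine u v.  Each edge e of G and vertex v of H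
  -- give an edge from (src e , v) to (tgt e , v); each vertex u of G and edge
  -- e of H give one from (u , src e) to (u , tgt e).
  _□_ : Graph
  _□_ = record
    { order    = order G * order H
    ; size     = E#
    ; src      = S
    ; tgt      = T
    ; loopless = λ i → loopless′ (edge i) ∘ code-injective
    ; simple   = simple′
    }

record Subgraph (G : Graph) : Set where
  constructor subgraph
  field
    vertices : Subset (order G)
    edges    : Subset (size G)
    .closed  : ∀ e → e ∈ edges → src G e ∈ vertices × tgt G e ∈ vertices

open Subgraph public

module _ {G : Graph} (H : Subgraph G) where

  Adjacent : Fin (order G) → Fin (order G) → Set
  Adjacent u v = ∃ λ e → e ∈ edges H × Joins G e u v

  Connected : Set
  Connected = ∀ u v → u ∈ vertices H → v ∈ vertices H → Star Adjacent u v

  -- The cycle v, v₁, …, vₙ, v with vs = v₁, …, vₙ.  As G is simple, a cycle is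
  -- determined by its vertices, of which there are at least three.
  IsCycle : Fin (order G) → List (Fin (order G)) → Set
  IsCycle v vs = 2 ≤ length vs × Unique (v ∷ vs) × Linked Adjacent (v ∷ (vs ∷ʳ v))

  Acyclic : Set
  Acyclic = ∀ v vs → ¬ IsCycle v vs

  IsTree : Set
  IsTree = Nonempty (vertices H) × Connected × Acyclic

Labeling : Graph → Set
Labeling G = Fin (size G) → Sign

weight : ∀ {G} → Labeling G → Subgraph G → ℤ
weight f H = sum ℤ.+-0-commutativeMonoid
  λ e → if Vec.lookup (edges H) e then f e ◃ 1 else 0ℤ

vectors : ∀ {A : Set} → List A → ∀ n → List (Vec A n)
vectors xs zero    = [] ∷ []
vectors xs (suc n) = cartesianProductWith _∷_ xs (vectors xs n)

subsets : ∀ n → List (Subset n)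
subsets = vectors (true ∷ false ∷ [])

-- Every labeling occurs, up to pointwise equality.
labelings : ∀ G → List (Labeling G)
labelings G = List.map Vec.lookup (vectors (Sign.+ ∷ Sign.- ∷ []) (size G))

closed? : ∀ G (vs : Subset (order G)) (es : Subset (size G)) →
          Dec (∀ e → e ∈ es → src G e ∈ vs × tgt G e ∈ vs)
closed? G vs es = all? λ e → (e ∈? es) →-dec ((src G e ∈? vs) ×-dec (tgt G e ∈? vs))

subgraph? : ∀ G → Subset (order G) × Subset (size G) → Maybe (Subgraph G)
subgraph? G (vs , es) = Maybe.map (λ c → subgraph vs es c) (dec⇒maybe (closed? G vs es))

-- Every subgraph occurs, as closed is irrelevant.
subgraphs : ∀ G → List (Subgraph G)
subgraphs G = mapMaybe (subgraph? G)
  (cartesianProduct (subsets (order G)) (subsets (size G)))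

module _ (G : Graph) (𝒮 : Subgraph G → Set) (𝒮? : Decidable 𝒮) where

  -- The initial value 0 matters only for an empty family 𝒮.
  maxWeight : Labeling G → ℕ
  maxWeight f = max 0 (List.map (λ H → ∣ weight f H ∣) (filter 𝒮? (subgraphs G)))

  -- min needs an initial value; the constant labeling supplies one that is
  -- itself among the values being minimised.
  discrepancy : ℕ
  discrepancy = min (maxWeight (λ _ → Sign.+)) (List.map maxWeight (labelings G))

∈-vectors : ∀ {A : Set} {xs : List A} → (∀ x → x List∈.∈ xs) →
            ∀ {n} (w : Vec A n) → w List∈.∈ vectors xs n
∈-vectors all []      = Any.here refl
∈-vectors all (x ∷ w) = ∈-cartesianProductWith⁺ _∷_ (all x) (∈-vectors all w)

private
  unique⇒length≤ : ∀ {n} {xs : List (Fin n)} → Unique xs → length xs ≤ n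
  unique⇒length≤ u = injective⇒≤ (lookup-injective u)
    where
    ∈-lookup : ∀ {A : Set} {P : A → Set} {xs} → All P xs → ∀ i → P (List.lookup xs i)
    ∈-lookup (px All.∷ _)   zero    = px
    ∈-lookup (_  All.∷ pxs) (suc i) = ∈-lookup pxs i

    lookup-injective : ∀ {A : Set} {xs : List A} → Unique xs → Injective _≡_ _≡_ (List.lookup xs)
    lookup-injective (_ ∷ _) {zero}  {zero}  _ = refl
    lookup-injective (x ∷ _) {zero}  {suc j} p = contradiction p (∈-lookup x j)
    lookup-injective (x ∷ _) {suc i} {zero}  p = contradiction (sym p) (∈-lookup x i)
    lookup-injective (_ ∷ u) {suc i} {suc j} p = cong suc (lookup-injective u p)

  module Reachability {n} {R : Fin n → Fin n → Set} (R? : Binary.Decidable R) where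

    -- Walks all of whose interior vertices lie in the given list.
    Via : List (Fin n) → Fin n → Fin n → Set
    Via []       u v = u ≡ v ⊎ R u v
    Via (z ∷ zs) u v = Via zs u v ⊎ (Via zs u z × Via zs z v)

    via? : ∀ zs → Binary.Decidable (Via zs)
    via? []       u v = (u ≟ v) ⊎-dec R? u v
    via? (z ∷ zs) u v = via? zs u v ⊎-dec (via? zs u z ×-dec via? zs z v)

    base : ∀ zs {u v} → u ≡ v ⊎ R u v → Via zs u v
    base []       p = p
    base (z ∷ zs) p = inj₁ (base zs p)

    via⇒star : ∀ zs {u v} → Via zs u v → Star R u v
    via⇒star []       (inj₁ refl)    = ε
    via⇒star []       (inj₂ r)       = r ◅ ε
    via⇒star (z ∷ zs) (inj₁ p)       = via⇒star zs p
    via⇒star (z ∷ zs) (inj₂ (p , q)) = via⇒star zs p ◅◅ via⇒star zs q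

    glue : ∀ zs {u w v} → w List∈.∈ zs → Via zs u w → Via zs w v → Via zs u v
    glue (z ∷ zs) (Any.here refl) p q = inj₂ (into p , out q)
      where
      into : ∀ {u} → Via (z ∷ zs) u z → Via zs u z
      into (inj₁ p)       = p
      into (inj₂ (p , _)) = p
      out : ∀ {v} → Via (z ∷ zs) z v → Via zs z v
      out (inj₁ p)       = p
      out (inj₂ (_ , p)) = p
    glue (z ∷ zs) (Any.there w) (inj₁ p)       (inj₁ q)       = inj₁ (glue zs w p q)
    glue (z ∷ zs) (Any.there w) (inj₁ p)       (inj₂ (q , r)) = inj₂ (glue zs w p q , r)
    glue (z ∷ zs) (Any.there w) (inj₂ (p , q)) (inj₁ r)       = inj₂ (p , glue zs w q r)
    glue (z ∷ zs) (Any.there w) (inj₂ (p , _)) (inj₂ (_ , r)) = inj₂ (p , r)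

    star⇒via : ∀ {u v} → Star R u v → Via (allFin n) u v
    star⇒via ε        = base (allFin n) (inj₁ refl)
    star⇒via (r ◅ rs) = glue (allFin n) (∈-allFin _) (base (allFin n) (inj₂ r)) (star⇒via rs)

    star? : Binary.Decidable (Star R)
    star? u v = map′ (via⇒star (allFin n)) star⇒via (via? (allFin n) u v)

module _ {G : Graph} (H : Subgraph G) where
  private
    joins? : ∀ e u v → Dec (Joins G e u v)
    joins? e u v = ((src G e ≟ u) ×-dec (tgt G e ≟ v)) ⊎-dec ((src G e ≟ v) ×-dec (tgt G e ≟ u))

    adjacent? : Binary.Decidable (Adjacent H)
    adjacent? u v = any? λ e → (e ∈? edges H) ×-dec joins? e u v

    connected? : Dec (Connected H)
    connected? = all? λ u → all? λ v →
      (u ∈? vertices H) →-dec ((v ∈? vertices H) →-dec Reachability.star? adjacent? u v)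

    isCycle? : ∀ v vs → Dec (IsCycle H v vs)
    isCycle? v vs = (2 ℕ.≤? length vs) ×-dec
      (DecUnique.unique? _≟_ (v ∷ vs) ×-dec linked? adjacent? (v ∷ (vs ∷ʳ v)))

    cycle? : Dec (∃₂ λ v vs → IsCycle H v vs)
    cycle? = any? λ v → map′ found search
      (any? λ i → Any.any? (λ w → isCycle? v (Vec.toList w)) (words (toℕ i)))
      where
      words : ∀ n → List (Vec (Fin (order G)) n)
      words = vectors (allFin (order G))

      Found : Fin (order G) → Set
      Found v = ∃ λ (i : Fin (order G)) →
        Any.Any (λ w → IsCycle H v (Vec.toList w)) (words (toℕ i))

      found : ∀ {v} → Found v → ∃ (IsCycle H v)
      found (_ , p) = Product.map Vec.toList (λ q → q) (Any.satisfied p)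

      hit : ∀ {v vs n} → length vs ≡ n → IsCycle H v vs →
            Any.Any (λ w → IsCycle H v (Vec.toList w)) (words n)
      hit {v} {vs} refl c = Any.map
        (λ { refl → subst (IsCycle H v) (sym (toList∘fromList vs)) c })
        (∈-vectors ∈-allFin (Vec.fromList vs))

      search : ∀ {v} → ∃ (IsCycle H v) → Found v
      search (vs , c@(_ , u , _)) =
        fromℕ< (unique⇒length≤ u) ,
        hit (sym (toℕ-fromℕ< (unique⇒length≤ u))) c

  isTree? : Dec (IsTree H)
  isTree? = nonempty? (vertices H) ×-dec (connected? ×-dec
    map′ (λ ¬c v vs c → ¬c (v , vs , c)) (λ { a (v , vs , c) → a v vs c }) (¬? cycle?))

{-# OPTIONS --safe #-}

-- A tree with L leaf edges forces discrepancy at least L/2: among these leaf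
-- edges keep only the positive ones, or only the negative ones; the weights of
-- the two resulting trees differ by L.  In the k × ℓ grid the tree made of the
-- first column, of all even rows, and of the edges leading down from the even
-- rows has about kℓ/2 leaf edges.
module Submission where

open import Defs
open import Algebra.Properties.CommutativeMonoid.Sum using (sum)
open import Data.Bool.Base using (Bool; true; false; if_then_else_)
open import Data.Fin.Base as Fin
  using (Fin; zero; suc; toℕ; inject₁; combine; remQuot; splitAt; join)
open import Data.Fin.Induction using (<-wellFounded)
import Data.Fin.Properties as Fin
open import Data.Fin.Subset using (Subset; _∈_)
open import Data.Fin.Subset.Properties using (_∈?_)
open import Data.Integer.Base as ℤ using (ℤ; +_; ∣_∣; _◃_; 0ℤ)
import Data.Integer.Properties as ℤ
import Data.Integer.Solver as ℤSolver
open import Data.List.Base using ([]; _∷_; _∷ʳ_)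
open import Data.List.Extrema.Nat using (argmin-all; v≤max⁺)
import Data.List.Membership.Propositional as List∈
open import Data.List.Membership.Propositional.Properties
  using (∈-map⁺; ∈-filter⁺; ∈-cartesianProduct⁺)
open import Data.List.Relation.Unary.All as All using (All)
import Data.List.Relation.Unary.All.Properties as All
open import Data.List.Relation.Unary.AllPairs using ([]; _∷_)
open import Data.List.Relation.Unary.Any as Any using (here; there)
import Data.List.Relation.Unary.Any.Properties as Any
open import Data.List.Relation.Unary.Linked using (Linked; _∷_)
open import Data.List.Relation.Unary.Unique.Propositional using (Unique)
import Data.Maybe.Relation.Unary.Any as Maybe
open import Data.Nat.Base as ℕ using (ℕ; zero; suc; _+_; _*_; _⊔_; _⊓_; _≤_; z≤n; s≤s; parity)
import Data.Nat.Properties as ℕ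
open import Algebra.Properties.CommutativeMonoid.Sum ℕ.+-0-commutativeMonoid using (sum-cong-≗)
import Data.Nat.Solver as ℕSolver
open import Data.Parity.Base using (Parity; 0ℙ; 1ℙ)
open import Data.Product.Base as Product
  using (∃-syntax; _×_; _,_; proj₁; proj₂; uncurry; Σ-syntax)
open import Data.Rational.Unnormalised.Base using (_/_; _-_; _<_; *<*)
open import Data.Sign.Base as Sign using (Sign)
import Data.Sign.Properties as Sign
open import Data.Sum.Base as Sum using (_⊎_; inj₁; inj₂; [_,_])
open import Data.Vec.Base using (tabulate; lookup)
open import Data.Vec.Properties using (lookup∘tabulate; lookup⇒[]=; []=⇒lookup)
open import Function.Base using (_∘_)
open import Induction.WellFounded using (Acc; acc)
open import Relation.Binary.Construct.Closure.ReflexiveTransitive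
  using (Star; ε; _◅_; _◅◅_; reverse)
open import Relation.Binary.Core using (Rel)
open import Relation.Binary.PropositionalEquality
  using (_≡_; _≢_; refl; sym; trans; cong; cong₂; subst; module ≡-Reasoning)
open import Relation.Nullary using (Dec; yes; no; does; contradiction)
open import Relation.Nullary.Decidable using (_×-dec_; _⊎-dec_; dec-true)
open import Relation.Nullary.Negation using (contradiction-irr)
open import Relation.Unary using (Decidable)

-- Subsets given by Boolean predicates

∈-tabulate⁺ : ∀ {n} (p : Fin n → Bool) {i} → p i ≡ true → i ∈ tabulate p
∈-tabulate⁺ p {i} eq = lookup⇒[]= i _ (trans (lookup∘tabulate p i) eq)

∈-tabulate⁻ : ∀ {n} (p : Fin n → Bool) {i} → i ∈ tabulate p → p i ≡ true
∈-tabulate⁻ p {i} i∈ = trans (sym (lookup∘tabulate p i)) ([]=⇒lookup i∈)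

does-true : ∀ {A : Set} (a? : Dec A) → does a? ≡ true → A
does-true (yes a) _ = a

-- Discrepancy as a minimum of maxima

∈-subgraphs : ∀ {G} (H : Subgraph G) → H List∈.∈ subgraphs G
∈-subgraphs {G} (subgraph vs es c) =
  Any.mapMaybe⁺ (subgraph? G) _
    (Any.map⁺ (Any.map (λ { refl → hit })
      (∈-cartesianProduct⁺ (∈-vectors bool vs) (∈-vectors bool es))))
  where
  bool : ∀ b → b List∈.∈ (true ∷ false ∷ [])
  bool true  = here refl
  bool false = there (here refl)
  hit : Maybe.Any (subgraph vs es c ≡_) (subgraph? G (vs , es))
  hit with closed? G vs es
  -- As `closed` is irrelevant, the subgraph built from the decided proof is definitionally the
  -- given one.
  ... | yes _ = Maybe.just refl
  ... | no ¬c = contradiction-irr c ¬c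

module _ (G : Graph) (𝒮 : Subgraph G → Set) (𝒮? : Decidable 𝒮) where

  weight≤maxWeight : ∀ f H → 𝒮 H → ∣ weight f H ∣ ≤ maxWeight G 𝒮 𝒮? f
  weight≤maxWeight f H H∈𝒮 = v≤max⁺ 0 _ (inj₂ (Any.map ℕ.≤-reflexive
    (∈-map⁺ _ (∈-filter⁺ 𝒮? (∈-subgraphs H) H∈𝒮))))

  -- The minimum is attained: it is one of the values `maxWeight f`, the initial one included, so
  -- whatever holds of all these values holds of it.
  discrepancy-all : (P : ℕ → Set) → (∀ f → P (maxWeight G 𝒮 𝒮? f)) → P (discrepancy G 𝒮 𝒮?)
  discrepancy-all P all =
    argmin-all (λ x → x) {P = P} (all (λ _ → Sign.+)) (All.map⁺ (All.universal all (labelings G)))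

-- Trees given by parent edges

-- Edges point from parent to child. `src-unique` allows one parent per vertex, and `src-reached`
-- lets a climb through parents stop only at `root`; `increasing` makes every climb finite and rules
-- out directed cycles.
module Arborescence
  {G : Graph} (increasing : ∀ e → src G e Fin.< tgt G e)
  (E : Subset (size G)) (root : Fin (order G))
  (src-unique : ∀ {e e′} → e ∈ E → e′ ∈ E → tgt G e ≡ tgt G e′ → src G e ≡ src G e′)
  (src-reached : ∀ {e} → e ∈ E → src G e ≡ root ⊎ ∃[ e′ ] e′ ∈ E × tgt G e′ ≡ src G e)
  where

  -- The root is listed separately so that an empty `E` still yields a tree, the single vertex
  -- `root`.
  Covered : Fin (order G) → Set
  Covered v = v ≡ root ⊎ ∃[ e ] e ∈ E × (src G e ≡ v ⊎ tgt G e ≡ v)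

  covered? : Decidable Covered
  covered? v = (v Fin.≟ root) ⊎-dec
    Fin.any? (λ e → (e ∈? E) ×-dec ((src G e Fin.≟ v) ⊎-dec (tgt G e Fin.≟ v)))

  covered⇒∈ : ∀ {v} → Covered v → v ∈ tabulate (does ∘ covered?)
  covered⇒∈ {v} c = ∈-tabulate⁺ _ (dec-true (covered? v) c)

  tree : Subgraph G
  tree = subgraph (tabulate (does ∘ covered?)) E λ e e∈E →
    covered⇒∈ (inj₂ (e , e∈E , inj₁ refl)) , covered⇒∈ (inj₂ (e , e∈E , inj₂ refl))

  Parent : Rel (Fin (order G)) _
  Parent u v = ∃[ e ] e ∈ E × src G e ≡ u × tgt G e ≡ v

  parent-< : ∀ {u v} → Parent u v → u Fin.< v
  parent-< (e , _ , refl , refl) = increasing e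

  parent-unique : ∀ {u u′ v} → Parent u v → Parent u′ v → u ≡ u′
  parent-unique (_ , e∈E , refl , p) (_ , e′∈E , refl , q) =
    src-unique e∈E e′∈E (trans p (sym q))

  adjacent⇒parent : ∀ {u v} → Adjacent tree u v → Parent u v ⊎ Parent v u
  adjacent⇒parent (e , e∈E , inj₁ (p , q)) = inj₁ (e , e∈E , p , q)
  adjacent⇒parent (e , e∈E , inj₂ (p , q)) = inj₂ (e , e∈E , p , q)

  adjacent-sym : ∀ {u v} → Adjacent tree u v → Adjacent tree v u
  adjacent-sym (e , e∈E , j) = e , e∈E , Sum.swap j

  connected : Connected tree
  connected u v u∈ v∈ = toRoot u u∈ ◅◅ reverse adjacent-sym (toRoot v v∈)
    where
    -- Well-founded recursion on the number of the source: by `increasing`, its parent has a smaller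
    -- one.
    srcToRoot : ∀ {e} → e ∈ E → Acc Fin._<_ (src G e) → Star (Adjacent tree) (src G e) root
    srcToRoot e∈E (acc rec) with src-reached e∈E
    ... | inj₁ p = subst (Star _ _) p ε
    ... | inj₂ (e′ , e′∈E , p) =
      (e′ , e′∈E , inj₂ (refl , p)) ◅
      srcToRoot e′∈E (rec (subst (src G e′ Fin.<_) p (increasing e′)))

    toRoot : ∀ v → v ∈ vertices tree → Star (Adjacent tree) v root
    toRoot v v∈ with does-true (covered? v) (∈-tabulate⁻ _ v∈)
    ... | inj₁ refl = ε
    ... | inj₂ (e , e∈E , inj₁ refl) = srcToRoot e∈E (<-wellFounded _)
    ... | inj₂ (e , e∈E , inj₂ refl) =
      (e , e∈E , inj₂ (refl , refl)) ◅ srcToRoot e∈E (<-wellFounded _)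

  -- A walk that never backtracks cannot turn upwards after a downward step.
  descend : ∀ {v x y} zs → Parent x y → Linked (Adjacent tree) (y ∷ (zs ∷ʳ v)) →
            Unique (x ∷ y ∷ zs) → All (v ≢_) (x ∷ y ∷ zs) →
            y Fin.< v × ∃[ w ] w List∈.∈ (y ∷ zs) × Parent w v
  descend [] xy (a ∷ _) _ (v≢x All.∷ _) with adjacent⇒parent a
  ... | inj₁ yv = parent-< yv , _ , here refl , yv
  ... | inj₂ vy = contradiction (parent-unique vy xy) v≢x
  descend (z ∷ zs) xy (a ∷ as) ((_ All.∷ x≢z All.∷ _) ∷ u) (_ All.∷ vs) with adjacent⇒parent a
  ... | inj₂ zy = contradiction (parent-unique xy zy) x≢z
  ... | inj₁ yz with descend zs yz as u vs
  ...   | z<v , w , w∈ , wv = ℕ.<-trans (parent-< yz) z<v , w , there w∈ , wv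

  -- Vertex numbers fall as long as the walk moves to parents. If it does so all the way, `v` is
  -- numbered lower than `x`. From the first step down on, the walk only descends, so it enters `v`
  -- from a parent.
  climb : ∀ {v x y} zs → Linked (Adjacent tree) (x ∷ y ∷ (zs ∷ʳ v)) →
          Unique (x ∷ y ∷ zs) → All (v ≢_) (x ∷ y ∷ zs) →
          v Fin.< x ⊎ ∃[ w ] w List∈.∈ (y ∷ zs) × Parent w v
  climb zs (a ∷ as) u vs with adjacent⇒parent a
  ... | inj₁ xy = inj₂ (proj₂ (descend zs xy as u vs))
  climb [] (_ ∷ a ∷ _) u vs | inj₂ yx with adjacent⇒parent a
  ... | inj₁ yv = inj₂ (_ , here refl , yv)
  ... | inj₂ vy = inj₁ (ℕ.<-trans (parent-< vy) (parent-< yx))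
  climb (z ∷ zs) (_ ∷ as) (_ ∷ u) (_ All.∷ vs) | inj₂ yx with climb zs as u vs
  ... | inj₁ v<y = inj₁ (ℕ.<-trans v<y (parent-< yx))
  ... | inj₂ (w , w∈ , wv) = inj₂ (w , there w∈ , wv)

  -- Walk round the cycle from `v`. If the first step goes to a parent `x`, then `climb` either
  -- numbers `v` lower than its own parent or yields a parent `w` of `v` that differs from `x`, the
  -- vertices of a cycle being distinct. If the first step goes to a child, the walk must keep
  -- descending, and the numbers increase all the way back to `v`.
  acyclic : Acyclic tree
  acyclic v (_ ∷ []) (s≤s () , _)
  acyclic v (x ∷ y ∷ zs) (_ , vs ∷ u , a ∷ as) with adjacent⇒parent a
  acyclic v (x ∷ y ∷ zs) (_ , vs ∷ u@(x≢ ∷ _) , _ ∷ as) | inj₂ xv with climb zs as u vs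
  ... | inj₁ v<x = ℕ.<-asym v<x (parent-< xv)
  ... | inj₂ (w , w∈ , wv) = All.lookup x≢ w∈ (parent-unique xv wv)
  acyclic v (x ∷ y ∷ zs) (_ , vs@(_ All.∷ v≢y All.∷ _) ∷ u , _ ∷ b ∷ as) | inj₁ vx
    with adjacent⇒parent b
  ... | inj₂ yx = v≢y (parent-unique vx yx)
  ... | inj₁ xy = ℕ.<-asym (proj₁ (descend zs xy as u vs))
                    (ℕ.<-trans (parent-< vx) (parent-< xy))

  isTree : IsTree tree
  isTree = (root , covered⇒∈ (inj₁ refl)) , connected , acyclic

-- Switching the leaf edges of a tree

data Role : Set where
  core leaf absent : Role

kept : Sign → Role → Sign → Bool
kept s core   t = true
kept s leaf   t = does (t Sign.≟ s)
kept s absent t = false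

leaves : Role → ℕ
leaves leaf = 1
leaves _    = 0

kept⇒≢absent : ∀ s r t → kept s r t ≡ true → r ≢ absent
kept⇒≢absent s absent t () refl

kept-core : ∀ s r t → r ≡ core → kept s r t ≡ true
kept-core s core t _ = refl

sumℕ : ∀ {n} → (Fin n → ℕ) → ℕ
sumℕ = sum ℕ.+-0-commutativeMonoid

sum-+-difference : ∀ {n} (t u : Fin n → ℤ) (g : Fin n → ℕ) → (∀ i → t i ≡ u i ℤ.+ + g i) →
  sum ℤ.+-0-commutativeMonoid t ≡ sum ℤ.+-0-commutativeMonoid u ℤ.+ + sumℕ g
sum-+-difference {zero}  t u g eq = refl
sum-+-difference {suc n} t u g eq = trans
  (cong₂ ℤ._+_ (eq zero) (sum-+-difference (t ∘ suc) (u ∘ suc) (g ∘ suc) (eq ∘ suc)))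
  (trans (interchange (u zero) (+ g zero) ∑u (+ sumℕ (g ∘ suc)))
    (cong (ℤ._+_ (u zero ℤ.+ ∑u)) (sym (ℤ.pos-+ (g zero) _))))
  where
  ∑u = sum ℤ.+-0-commutativeMonoid (u ∘ suc)
  open ℤSolver.+-*-Solver
  interchange : ∀ a b c d → (a ℤ.+ b) ℤ.+ (c ℤ.+ d) ≡ (a ℤ.+ c) ℤ.+ (b ℤ.+ d)
  interchange = solve 4 (λ a b c d → (a :+ b) :+ (c :+ d) := (a :+ c) :+ (b :+ d)) refl

-- By the triangle inequality `n` is at most the sum of the two absolute values, hence at most twice
-- the larger one.
larger-half : ∀ x y {n} → x ≡ y ℤ.+ + n → n ≤ 2 * ∣ x ∣ ⊎ n ≤ 2 * ∣ y ∣
larger-half x y {n} eq = Sum.map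
  (λ y≤x → ℕ.≤-trans n≤ (ℕ.+-monoʳ-≤ ∣ x ∣ (ℕ.≤-trans y≤x (ℕ.m≤m+n _ 0))))
  (λ x≤y → ℕ.≤-trans n≤ (ℕ.+-mono-≤ x≤y (ℕ.m≤m+n _ 0)))
  (ℕ.≤-total ∣ y ∣ ∣ x ∣)
  where
  open ℤSolver.+-*-Solver
  cancel : ∀ i j → (i ℤ.+ j) ℤ.- i ≡ j
  cancel = solve 2 (λ i j → (i :+ j) :- i := j) refl

  n≤ : n ≤ ∣ x ∣ + ∣ y ∣
  n≤ = subst (_≤ ∣ x ∣ + ∣ y ∣)
    (cong ∣_∣ (trans (cong (ℤ._- y) eq) (cancel y (+ n)))) (ℤ.∣i-j∣≤∣i∣+∣j∣ x y)

-- `src-reached` asks for a `core` edge above each source other than the root. Such an edge survives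
-- whichever leaf edges are dropped, so both signs give an arborescence.
module LeafSwitching
  {G : Graph} (increasing : ∀ e → src G e Fin.< tgt G e)
  (role : Fin (size G) → Role) (root : Fin (order G))
  (src-unique : ∀ {e e′} → role e ≢ absent → role e′ ≢ absent →
                tgt G e ≡ tgt G e′ → src G e ≡ src G e′)
  (src-reached : ∀ {e} → role e ≢ absent →
                 src G e ≡ root ⊎ ∃[ e′ ] role e′ ≡ core × tgt G e′ ≡ src G e)
  (f : Labeling G)
  where

  keep : Sign → Fin (size G) → Bool
  keep s e = kept s (role e) (f e)

  present : ∀ s {e} → e ∈ tabulate (keep s) → role e ≢ absent
  present s {e} e∈ = kept⇒≢absent s (role e) (f e) (∈-tabulate⁻ (keep s) e∈)

  module Kept (s : Sign) = Arborescence {G} increasing (tabulate (keep s)) root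
    (λ e∈ e′∈ → src-unique (present s e∈) (present s e′∈))
    (λ e∈ → Sum.map₂
      (λ (e′ , c , p) → e′ , ∈-tabulate⁺ (keep s) (kept-core s (role e′) (f e′) c) , p)
      (src-reached (present s e∈)))

  -- A positive leaf edge contributes 1 to the first tree and 0 to the second, a negative one 0 and
  -- -1. Either way the difference is 1, while core edges cancel.
  weight-difference : weight f (Kept.tree Sign.+) ≡
                      weight f (Kept.tree Sign.-) ℤ.+ + sumℕ (leaves ∘ role)
  weight-difference = sum-+-difference {size G} _ _ _ λ e →
    trans (cong (if_then f e ◃ 1 else 0ℤ) (lookup∘tabulate (keep Sign.+) e))
      (trans (contribution (role e) (f e))
        (cong (λ b → (if b then f e ◃ 1 else 0ℤ) ℤ.+ + leaves (role e))
          (sym (lookup∘tabulate (keep Sign.-) e))))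
    where
    contribution : ∀ r t → (if kept Sign.+ r t then t ◃ 1 else 0ℤ) ≡
      (if kept Sign.- r t then t ◃ 1 else 0ℤ) ℤ.+ + leaves r
    contribution core   Sign.+ = refl
    contribution core   Sign.- = refl
    contribution leaf   Sign.+ = refl
    contribution leaf   Sign.- = refl
    contribution absent _      = refl

  heavyTree : ∃[ T ] IsTree T × sumℕ (leaves ∘ role) ≤ 2 * ∣ weight f T ∣
  heavyTree with larger-half (weight f (Kept.tree Sign.+)) (weight f (Kept.tree Sign.-)) weight-difference
  ... | inj₁ n≤ = Kept.tree Sign.+ , Kept.isTree Sign.+ , n≤
  ... | inj₂ n≤ = Kept.tree Sign.- , Kept.isTree Sign.- , n≤

-- The grid

sumℕ-splitAt : ∀ m {n} (g : Fin m ⊎ Fin n → ℕ) →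
  sumℕ (g ∘ splitAt m) ≡ sumℕ (g ∘ inj₁) + sumℕ (g ∘ inj₂)
sumℕ-splitAt zero    g = refl
sumℕ-splitAt (suc m) g = trans
  (cong (ℕ._+_ (g (inj₁ zero))) (sumℕ-splitAt m (g ∘ Sum.map₁ suc)))
  (sym (ℕ.+-assoc (g (inj₁ zero)) _ _))

sumℕ-remQuot : ∀ m n (g : Fin m × Fin n → ℕ) →
  sumℕ (g ∘ remQuot {m} n) ≡ sumℕ (λ i → sumℕ (λ j → g (i , j)))
sumℕ-remQuot zero    n g = refl
sumℕ-remQuot (suc m) n g = trans
  (sum-cong-≗ step)
  (trans (sumℕ-splitAt n [ (λ j → g (zero , j)) , (λ i → g (Product.map₁ suc (remQuot {m} n i))) ])
    (cong (ℕ._+_ _) (sumℕ-remQuot m n (g ∘ Product.map₁ suc))))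
  where
  step : ∀ i → g (remQuot {suc m} n i) ≡
    [ (λ j → g (zero , j)) , (λ i → g (Product.map₁ suc (remQuot {m} n i))) ] (splitAt n i)
  step i with splitAt n i
  ... | inj₁ _ = refl
  ... | inj₂ _ = refl

sumℕ-const : ∀ n c → sumℕ {n} (λ _ → c) ≡ n * c
sumℕ-const zero    c = refl
sumℕ-const (suc n) c = cong (ℕ._+_ c) (sumℕ-const n c)

path-increasing : ∀ n e → src (path n) e Fin.< tgt (path n) e
path-increasing (suc n) e = s≤s (ℕ.≤-reflexive (Fin.toℕ-inject₁ e))

combine-monoʳ-< : ∀ {m n} (i : Fin m) {j k : Fin n} → j Fin.< k → combine i j Fin.< combine i k
combine-monoʳ-< {m} {n} i {j} {k} j<k = begin-strict
  toℕ (combine i j)  ≡⟨ Fin.toℕ-combine i j ⟩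
  n * toℕ i + toℕ j  <⟨ ℕ.+-monoʳ-< (n * toℕ i) j<k ⟩
  n * toℕ i + toℕ k  ≡⟨ Fin.toℕ-combine i k ⟨
  toℕ (combine i k)  ∎
  where open ℕ.≤-Reasoning

-- `combine` numbers pairs lexicographically, so raising one coordinate and fixing the other raises
-- the number.
□-increasing : ∀ {G H} → (∀ e → src G e Fin.< tgt G e) → (∀ e → src H e Fin.< tgt H e) →
               ∀ e → src (G □ H) e Fin.< tgt (G □ H) e
□-increasing {G} {H} G< H< e with splitAt (size G * order H) e
... | inj₁ x = Fin.combine-monoˡ-< _ _ (G< (proj₁ (remQuot {size G} (order H) x)))
... | inj₂ y = combine-monoʳ-< (proj₁ (remQuot {order G} (size H) y)) (H< (proj₂ (remQuot {order G} (size H) y)))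

module Grid (a b : ℕ) where

  grid : Graph
  grid = path (suc a) □ path (suc b)

  -- The first coordinate is the row, counted from 0: `inj₁` holds the vertical edges, `inj₂` the
  -- horizontal ones.
  Edge : Set
  Edge = (Fin a × Fin (suc b)) ⊎ (Fin (suc a) × Fin b)

  source target : Edge → Fin (suc a) × Fin (suc b)
  source (inj₁ (i , j)) = inject₁ i , j
  source (inj₂ (i , j)) = i , inject₁ j
  target (inj₁ (i , j)) = suc i , j
  target (inj₂ (i , j)) = i , suc j

  -- Repeats the edge coding inside `_□_`, which is private there; `src-decode` and `tgt-decode` tie
  -- the two together.
  decode : Fin (size grid) → Edge
  decode = Sum.map (remQuot (suc b)) (remQuot b) ∘ splitAt (a * suc b)

  encode : Edge → Fin (size grid)
  encode = join (a * suc b) (suc a * b) ∘ Sum.map (uncurry combine) (uncurry combine)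

  decode-encode : ∀ x → decode (encode x) ≡ x
  decode-encode (inj₁ (i , j)) rewrite Fin.splitAt-↑ˡ (a * suc b) (combine i j) (suc a * b) =
    cong inj₁ (Fin.remQuot-combine i j)
  decode-encode (inj₂ (i , j)) rewrite Fin.splitAt-↑ʳ (a * suc b) (suc a * b) (combine i j) =
    cong inj₂ (Fin.remQuot-combine i j)

  src-decode : ∀ e → src grid e ≡ uncurry combine (source (decode e))
  src-decode e with splitAt (a * suc b) e
  ... | inj₁ _ = refl
  ... | inj₂ _ = refl

  tgt-decode : ∀ e → tgt grid e ≡ uncurry combine (target (decode e))
  tgt-decode e with splitAt (a * suc b) e
  ... | inj₁ _ = refl
  ... | inj₂ _ = refl

  evenRow : Role → Parity → Role
  evenRow r 0ℙ = r
  evenRow r 1ℙ = absent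

  -- For a vertical edge the parity tested is that of its upper row. Thus `leaf` edges end in odd
  -- rows, whose horizontal edges are all `absent`.
  role : Edge → Role
  role (inj₁ (i , zero))  = core
  role (inj₁ (i , suc j)) = evenRow leaf (parity (toℕ i))
  role (inj₂ (i , j))     = evenRow core (parity (toℕ i))

  evenRow-≢absent : ∀ r p → evenRow r p ≢ absent → p ≡ 0ℙ
  evenRow-≢absent r 0ℙ _ = refl
  evenRow-≢absent r 1ℙ p = contradiction refl p

  not-both-even : ∀ n → parity n ≡ 0ℙ → parity (suc n) ≢ 0ℙ
  not-both-even (suc (suc n)) p q = not-both-even n p q

  -- Two edges of the same direction are determined by their target. A vertical and a horizontal
  -- edge can only meet outside the first column; both being present would then make two consecutive
  -- rows even.
  source-unique : ∀ x y → role x ≢ absent → role y ≢ absent →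
                  target x ≡ target y → source x ≡ source y
  source-unique (inj₁ _) (inj₁ _) _ _ refl = refl
  source-unique (inj₂ _) (inj₂ _) _ _ refl = refl
  source-unique (inj₁ (i , suc j)) (inj₂ _) p q refl = contradiction
    (evenRow-≢absent core _ q) (not-both-even (toℕ i) (evenRow-≢absent leaf _ p))
  source-unique (inj₂ _) (inj₁ (i , suc j)) p q refl = contradiction
    (evenRow-≢absent core _ p) (not-both-even (toℕ i) (evenRow-≢absent leaf _ q))

  -- Outside the first column the witness is the horizontal edge on the left of the source, which is
  -- `core` because the source lies in an even row. In the first column it is the vertical edge
  -- above.
  source-reached : ∀ x → role x ≢ absent →
    source x ≡ (zero , zero) ⊎ ∃[ y ] role y ≡ core × target y ≡ source x
  source-reached (inj₁ (zero  , zero))  _ = inj₁ refl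
  source-reached (inj₁ (suc i , zero))  _ = inj₂ (inj₁ (inject₁ i , zero) , refl , refl)
  source-reached (inj₁ (i     , suc j)) p = inj₂ (inj₂ (inject₁ i , j) ,
    cong (evenRow core) (trans (cong parity (Fin.toℕ-inject₁ i)) (evenRow-≢absent leaf _ p)) , refl)
  source-reached (inj₂ (i     , suc j)) p = inj₂ (inj₂ (i , inject₁ j) ,
    cong (evenRow core) (evenRow-≢absent core _ p) , refl)
  source-reached (inj₂ (zero  , zero))  _ = inj₁ refl
  source-reached (inj₂ (suc i , zero))  _ = inj₂ (inj₁ (i , zero) , refl , refl)

  src-unique : ∀ {e e′} → role (decode e) ≢ absent → role (decode e′) ≢ absent →
               tgt grid e ≡ tgt grid e′ → src grid e ≡ src grid e′
  src-unique {e} {e′} p q eq = begin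
    src grid e                          ≡⟨ src-decode e ⟩
    uncurry combine (source (decode e))  ≡⟨ cong (uncurry combine)
      (source-unique (decode e) (decode e′) p q (combine-injective′
        (trans (sym (tgt-decode e)) (trans eq (tgt-decode e′))))) ⟩
    uncurry combine (source (decode e′)) ≡⟨ src-decode e′ ⟨
    src grid e′                         ∎
    where
    open ≡-Reasoning
    combine-injective′ : ∀ {x y : Fin (suc a) × Fin (suc b)} →
                         uncurry combine x ≡ uncurry combine y → x ≡ y
    combine-injective′ {i , j} {k , l} eq = uncurry (cong₂ _,_) (Fin.combine-injective i j k l eq)

  src-reached : ∀ {e} → role (decode e) ≢ absent →
    src grid e ≡ combine {suc a} {suc b} zero zero ⊎
    ∃[ e′ ] role (decode e′) ≡ core × tgt grid e′ ≡ src grid e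
  src-reached {e} p = Sum.map
    (λ eq → trans (src-decode e) (cong (uncurry combine) eq))
    (λ (y , c , eq) → encode y , trans (cong role (decode-encode y)) c , (begin
      tgt grid (encode y)                             ≡⟨ tgt-decode (encode y) ⟩
      uncurry combine (target (decode (encode y)))     ≡⟨ cong (uncurry combine ∘ target) (decode-encode y) ⟩
      uncurry combine (target y)                       ≡⟨ cong (uncurry combine) eq ⟩
      uncurry combine (source (decode e))              ≡⟨ src-decode e ⟨
      src grid e                                      ∎))
    (source-reached (decode e) p)
    where open ≡-Reasoning

  -- Of each pair of consecutive rows the even one has `b` leaf edges and the odd one none; an
  -- unpaired last row is even, which only helps. The summand `0` is the `core` edge of the first
  -- column, so that the sum agrees definitionally with the one over all `suc b` columns.
  vertical-leaves : ∀ m → m * b ≤ 2 * sumℕ {m} λ i →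
    0 + sumℕ {b} (λ _ → leaves (evenRow leaf (parity (toℕ i))))
  vertical-leaves zero          = z≤n
  vertical-leaves (suc zero)    = begin
    b + 0                              ≡⟨ ℕ.+-identityʳ b ⟩
    b                                  ≤⟨ ℕ.m≤n*m b 2 ⟩
    2 * b                              ≡⟨ cong (ℕ._*_ 2) (trans (sumℕ-const b 1) (ℕ.*-identityʳ b)) ⟨
    2 * sumℕ {b} (λ _ → 1)             ≡⟨ cong (ℕ._*_ 2) (ℕ.+-identityʳ (sumℕ {b} (λ _ → 1))) ⟨
    2 * (sumℕ {b} (λ _ → 1) + 0)       ∎
    where open ℕ.≤-Reasoning
  vertical-leaves (suc (suc m)) = begin
    -- `parity` has period two by computation, so after two rows the remaining sum is `rest` itself.
    b + (b + m * b)                                ≤⟨ ℕ.+-monoʳ-≤ b (ℕ.+-monoʳ-≤ b (vertical-leaves m)) ⟩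
    b + (b + 2 * rest)                             ≡⟨ regroup b rest ⟩
    2 * (b + (0 + rest))                           ≡⟨ cong₂ (λ x y → 2 * (x + (y + rest)))
      (trans (sumℕ-const b 1) (ℕ.*-identityʳ b)) (trans (sumℕ-const b 0) (ℕ.*-zeroʳ b)) ⟨
    2 * (sumℕ {b} (λ _ → 1) + (sumℕ {b} (λ _ → 0) + rest)) ∎
    where
    open ℕ.≤-Reasoning
    rest = sumℕ {m} λ i → 0 + sumℕ {b} (λ _ → leaves (evenRow leaf (parity (toℕ i))))
    open ℕSolver.+-*-Solver
    regroup : ∀ x y → x + (x + 2 * y) ≡ 2 * (x + (0 + y))
    regroup = solve 2 (λ x y → x :+ (x :+ con 2 :* y) := con 2 :* (x :+ (con 0 :+ y))) refl

  many-leaves : a * b ≤ 2 * sumℕ (leaves ∘ role ∘ decode)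
  many-leaves = begin
    a * b
      ≤⟨ vertical-leaves a ⟩
    2 * sumℕ (λ i → sumℕ (λ j → leaves (role (inj₁ (i , j)))))
      ≡⟨ cong (ℕ._*_ 2) (sumℕ-remQuot a (suc b) (leaves ∘ role ∘ inj₁)) ⟨
    2 * sumℕ (leaves ∘ role ∘ inj₁ ∘ remQuot {a} (suc b))
      -- The sum over horizontal edges is discarded; none of them is a `leaf`.
      ≤⟨ ℕ.*-monoʳ-≤ 2 (ℕ.m≤m+n (sumℕ (leaves ∘ role ∘ inj₁ ∘ remQuot {a} (suc b))) _) ⟩
    2 * (sumℕ (leaves ∘ role ∘ inj₁ ∘ remQuot {a} (suc b)) +
         sumℕ (leaves ∘ role ∘ inj₂ ∘ remQuot {suc a} b))
      ≡⟨ cong (ℕ._*_ 2) (sumℕ-splitAt (a * suc b)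
           (leaves ∘ role ∘ Sum.map (remQuot {a} (suc b)) (remQuot {suc a} b))) ⟨
    2 * sumℕ (leaves ∘ role ∘ decode) ∎
    where open ℕ.≤-Reasoning

  heavyTree : ∀ f → ∃[ T ] IsTree T × a * b ≤ 4 * ∣ weight {grid} f T ∣
  heavyTree f with LeafSwitching.heavyTree {grid}
    (□-increasing {path (suc a)} {path (suc b)} (path-increasing (suc a)) (path-increasing (suc b)))
    (role ∘ decode) (combine {suc a} {suc b} zero zero) src-unique src-reached f
  ... | T , isTree , n≤ = T , isTree , (begin
    a * b                             ≤⟨ many-leaves ⟩
    2 * sumℕ (leaves ∘ role ∘ decode) ≤⟨ ℕ.*-monoʳ-≤ 2 n≤ ⟩
    -- One factor 2 is lost because only every other row carries leaf edges, the other in passing to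
    -- the heavier of two trees.
    2 * (2 * ∣ weight f T ∣)          ≡⟨ ℕ.*-assoc 2 2 ∣ weight f T ∣ ⟨
    4 * ∣ weight f T ∣                ∎)
    where open ℕ.≤-Reasoning

  discrepancy-bound : a * b ≤ 4 * discrepancy grid IsTree isTree?
  discrepancy-bound = discrepancy-all grid IsTree isTree? (λ n → a * b ≤ 4 * n) λ f →
    let T , isTree , ab≤ = heavyTree f in
    ℕ.≤-trans ab≤ (ℕ.*-monoʳ-≤ 4 (weight≤maxWeight grid IsTree isTree? f T isTree))

-- Arithmetic of the bound

⊔+⊓ : ∀ m n → m ⊔ n + m ⊓ n ≡ m + n
⊔+⊓ m n with ℕ.≤-total m n
... | inj₁ m≤n = trans (cong₂ _+_ (ℕ.m≤n⇒m⊔n≡n m≤n) (ℕ.m≤n⇒m⊓n≡m m≤n)) (ℕ.+-comm n m)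
... | inj₂ n≤m = cong₂ _+_ (ℕ.m≥n⇒m⊔n≡m n≤m) (ℕ.m≥n⇒m⊓n≡n n≤m)

quotient-bound : ∀ x m n w → x ℕ.< 8 * w + (m + 8 * n) →
  + x / 8 - + m / 8 - + n / 1 < + w / 1
quotient-bound x m n w x< = *<* (begin-strict
  -- The inequality after cross multiplication: the left fraction has denominator 8 * 8 * 1 = 64 and
  -- the right one 1. The hypothesis is then multiplied by 8, and `c` collects the subtracted terms.
  ((+ x ℤ.* + 8 ℤ.+ (ℤ.- + m) ℤ.* + 8) ℤ.* + 1 ℤ.+ (ℤ.- + n) ℤ.* + 64) ℤ.* + 1
    ≡⟨ lhs (+ x) (+ m) (+ n) ⟩
  + x ℤ.* + 8 ℤ.- c
    <⟨ ℤ.+-monoˡ-< (ℤ.- c) (ℤ.*-monoʳ-<-pos (+ 8) (ℤ.+<+ x<)) ⟩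
  + (8 * w + (m + 8 * n)) ℤ.* + 8 ℤ.- c
    ≡⟨ cong (λ y → y ℤ.* + 8 ℤ.- c) cast ⟩
  (+ 8 ℤ.* + w ℤ.+ (+ m ℤ.+ + 8 ℤ.* + n)) ℤ.* + 8 ℤ.- c
    ≡⟨ rhs (+ w) (+ m) (+ n) ⟩
  + w ℤ.* + 64
    ∎)
  where
  open ℤ.≤-Reasoning
  open ℤSolver.+-*-Solver
  c = + m ℤ.* + 8 ℤ.+ + n ℤ.* + 64
  cast : + (8 * w + (m + 8 * n)) ≡ + 8 ℤ.* + w ℤ.+ (+ m ℤ.+ + 8 ℤ.* + n)
  cast = trans (ℤ.pos-+ (8 * w) _) (cong₂ ℤ._+_ (ℤ.pos-* 8 w)
    (trans (ℤ.pos-+ m _) (cong (ℤ._+_ (+ m)) (ℤ.pos-* 8 n))))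
  lhs : ∀ x m n → ((x ℤ.* + 8 ℤ.+ (ℤ.- m) ℤ.* + 8) ℤ.* + 1 ℤ.+ (ℤ.- n) ℤ.* + 64) ℤ.* + 1 ≡
                  x ℤ.* + 8 ℤ.- (m ℤ.* + 8 ℤ.+ n ℤ.* + 64)
  lhs = solve 3 (λ x m n →
    ((x :* con (+ 8) :+ (:- m) :* con (+ 8)) :* con (+ 1) :+ (:- n) :* con (+ 64)) :* con (+ 1) :=
    x :* con (+ 8) :- (m :* con (+ 8) :+ n :* con (+ 64))) refl
  rhs : ∀ w m n → (+ 8 ℤ.* w ℤ.+ (m ℤ.+ + 8 ℤ.* n)) ℤ.* + 8 ℤ.- (m ℤ.* + 8 ℤ.+ n ℤ.* + 64) ≡
                  w ℤ.* + 64
  rhs = solve 3 (λ w m n →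
    (con (+ 8) :* w :+ (m :+ con (+ 8) :* n)) :* con (+ 8) :- (m :* con (+ 8) :+ n :* con (+ 64)) :=
    w :* con (+ 64)) refl

product-bound : ∀ a b w → a * b ≤ 4 * w →
  suc a * suc b ℕ.< 8 * w + (suc a ⊔ suc b + 8 * (suc a ⊓ suc b))
product-bound a b w ab≤ = begin-strict
  -- The strictness comes from the 1 in `(a + 1)(b + 1) + 1 = ab + (a + 1) + (b + 1)`.
  suc a * suc b           <⟨ ℕ.n<1+n _ ⟩
  suc (suc a * suc b)     ≡⟨ expand a b ⟩
  a * b + (suc a + suc b) ≡⟨ cong (ℕ._+_ (a * b)) (⊔+⊓ (suc a) (suc b)) ⟨
  -- Here `4 * w` is relaxed to `8 * w` and `m` to `8 * m` to reach the coefficients of the stated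
  -- bound.
  a * b + (M + m)         ≤⟨ ℕ.+-mono-≤ (ℕ.≤-trans ab≤ (ℕ.*-monoˡ-≤ w (ℕ.m≤m+n 4 4)))
                               (ℕ.+-monoʳ-≤ M (ℕ.m≤n*m m 8)) ⟩
  8 * w + (M + 8 * m)     ∎
  where
  open ℕ.≤-Reasoning
  M = suc a ⊔ suc b
  m = suc a ⊓ suc b
  open ℕSolver.+-*-Solver
  expand : ∀ a b → suc (suc a * suc b) ≡ a * b + (suc a + suc b)
  expand = solve 2 (λ a b →
    con 1 :+ (con 1 :+ a) :* (con 1 :+ b) := a :* b :+ ((con 1 :+ a) :+ (con 1 :+ b))) refl

corollary1p7 : ∀ (k ℓ : ℕ) → 1 ≤ k → 1 ≤ ℓ →
    let G     = path k □ path ℓ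
        bound = (+ (k * ℓ)) / 8 - (+ (k ⊔ ℓ)) / 8 - (+ (k ⊓ ℓ)) / 1
    in
    bound < (+ discrepancy G IsTree isTree?) / 1
    × (∀ (f : Labeling G) →
       Σ[ T ∈ Subgraph G ] (IsTree T × bound < (+ ∣ weight f T ∣) / 1))
corollary1p7 (suc a) (suc b) _ _ =
  -- Both conclusions follow from `a * b ≤ 4 * w`, with `w` the discrepancy here and the absolute
  -- weight of the tree for `f` below.
  bound< _ discrepancy-bound ,
  λ f → Product.map₂ (Product.map₂ (bound< _)) (heavyTree f)
  where
  open Grid a b
  bound< : ∀ w → a * b ≤ 4 * w →
    + (suc a * suc b) / 8 - + (suc a ⊔ suc b) / 8 - + (suc a ⊓ suc b) / 1 < + w / 1
  bound< w = quotient-bound (suc a * suc b) (suc a ⊔ suc b) (suc a ⊓ suc b) w ∘ product-bound a b w
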